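{- Suppose that $X \in 2^{\mathbb{N}}$ is random (in the sense of Martin-Löf). Then the values of $X$ obey the Strong Law of Large Numbers; that is, for $S_n = \sum_{i=0}^{n-1} X(i)$, $$\lim_{n\to\infty} \frac{S_n}{n} = \frac{1}{2}.$$
   Context: $2^{\mathbb{N}}$ is the Cantor space of all total functions $X:\mathbb{N}\to\{0,1\}$ (infinite binary sequences, indexed from $0$). For a finite bitstring $\sigma$, $N_\sigma$ is the set of $X\in 2^{\mathbb{N}}$ having $\sigma$ as an initial segment, and $\mu$ is the unique Borel measure on $2^{\mathbb{N}}$ with $\mu(N_\sigma)=2^{ -|\sigma|}$ for every bitstring $\sigma$. $\varphi_e^{X}(x)$ denotes the output (if it halts) of the program with Gödel number $e$ on input $x$ with oracle $X$. The $\Sigma^0_1$ subsets of $2^{\mathbb{N}}$ are enumerated by $S_e=\{X\in 2^{\mathbb{N}}:\varphi_e^X(0)\downarrow\}$, where $\downarrow$ means "is defined". A sequence $(V_n)_{n\in\mathbb{N}}$ of $\Sigma^0_1$ sets is uniformly $\Sigma^0_1$ if there is a total recursive function $f$ with $V_n=S_{f(n)}$ for all $n$. A set $S\subseteq 2^{\mathbb{N}}$ is effectively null if $S\subseteq\bigcap_{n=0}^\infty V_n$ for some uniformly $\Sigma^0_1$ sequence $(V_n)$ with $\mu(V_n)\le 2^{ -n}$ for all $n$. A point $X\in 2^{\mathbb{N}}$ is random (in the sense of Martin-Löf) if it does not lie in any effectively null set. -}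

module Defs where

open import Data.Empty using (⊥-elim)
open import Data.Fin.Base as Fin using (Fin; toℕ)
open import Data.Integer.Base using (+_)
open import Data.List.Base using (List; length; lookup)
open import Data.Nat.Base as ℕ using (ℕ; zero; suc; NonZero)
import Data.Nat.Properties as ℕ
open import Data.Product.Base using (Σ; Σ-syntax; ∃; ∃-syntax; _×_; _,_; proj₁; proj₂)
open import Data.Rational.Base as ℚ using (ℚ; 0ℚ; NonNegative)
import Data.Rational.Properties as ℚ
open import Level using (0ℓ)
open import Relation.Binary.Definitions using (tri<; tri≈; tri>)
open import Relation.Binary.PropositionalEquality
open import Relation.Nullary.Negation.Core using (¬_)
open import Relation.Unary using (Pred; _∈_; _⊆_; _≐_; _⊥_; ∁; ⋃; ∅)

Cantor : Set
Cantor = ℕ → Fin 2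

-- Elements of Cantor are only ever compared pointwise: no function
-- extensionality is assumed.
N : List (Fin 2) → Pred Cantor 0ℓ
N σ X = ∀ (i : Fin (length σ)) → X (toℕ i) ≡ lookup σ i

IsOpen : Pred Cantor 0ℓ → Set
IsOpen A = ∀ X → X ∈ A → ∃[ σ ] (X ∈ N σ × N σ ⊆ A)

-- `≐-closed` is needed because subsets are predicates, whose equality is
-- mutual inclusion.
data IsBorel : Pred Cantor 0ℓ → Set₁ where
  open-set   : ∀ {A} → IsOpen A → IsBorel A
  complement : ∀ {A} → IsBorel A → IsBorel (∁ A)
  union      : ∀ {A : ℕ → Pred Cantor 0ℓ} → (∀ n → IsBorel (A n)) → IsBorel (⋃ ℕ A)
  ≐-closed   : ∀ {A B} → A ≐ B → IsBorel A → IsBorel B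

record BorelSet : Set₁ where
  constructor _,ᴮ_
  field
    set     : Pred Cantor 0ℓ
    isBorel : IsBorel set

open BorelSet public

N-open : ∀ σ → IsOpen (N σ)
N-open σ X X∈Nσ = σ , X∈Nσ , λ {Y} Y∈Nσ → Y∈Nσ

Nᴮ : List (Fin 2) → BorelSet
Nᴮ σ = N σ ,ᴮ open-set (N-open σ)

∅ᴮ : BorelSet
∅ᴮ = ∅ ,ᴮ open-set λ X ()

⋃ᴮ : (ℕ → BorelSet) → BorelSet
⋃ᴮ A = ⋃ ℕ (λ n → set (A n)) ,ᴮ union (λ n → isBorel (A n))

-- The extended half-line [0,∞] as one-sided Dedekind cuts: a number
-- x is given by the set {q ∈ ℚ : q < x}; the cut containing every rational
-- is ∞.
record ℝ≥0∞ : Set₁ where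
  field
    below    : ℚ → Set
    negative : ∀ {q} → q ℚ.< 0ℚ → below q
    lower    : ∀ {p q} → p ℚ.< q → below q → below p
    rounded  : ∀ {q} → below q → ∃[ r ] (q ℚ.< r × below r)

open ℝ≥0∞ public

infix 4 _≤_ _≈_

_≤_ : ℝ≥0∞ → ℝ≥0∞ → Set
x ≤ y = ∀ {q} → below x q → below y q

_≈_ : ℝ≥0∞ → ℝ≥0∞ → Set
x ≈ y = x ≤ y × y ≤ x

fromℚ : (q : ℚ) → .{{NonNegative q}} → ℝ≥0∞
fromℚ q = record
  { below    = ℚ._< q
  ; negative = λ r<0 → ℚ.<-≤-trans r<0 (ℚ.nonNegative⁻¹ q)
  ; lower    = ℚ.<-trans
  ; rounded  = λ r<q → let s , r<s , s<q = ℚ.<-dense r<q in s , r<s , s<q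
  }

infixl 6 _+_

_+_ : ℝ≥0∞ → ℝ≥0∞ → ℝ≥0∞
x + y = record
  { below    = below′
  ; negative = λ {q} q<0 →
      let m , q<m , m<0 = ℚ.<-dense q<0
      in m , q ℚ.- m , negative x m<0
       , negative y (subst (q ℚ.- m ℚ.<_) (ℚ.+-inverseʳ m) (ℚ.+-monoˡ-< (ℚ.- m) q<m))
       , sym (cancel m q)
  ; lower    = lower′
  ; rounded  = rounded′
  }
  where
  cancel′ : ∀ a b → (a ℚ.+ b) ℚ.- a ≡ b
  cancel′ a b = begin
    (a ℚ.+ b) ℚ.- a    ≡⟨ cong (ℚ._- a) (ℚ.+-comm a b) ⟩
    (b ℚ.+ a) ℚ.- a    ≡⟨ ℚ.+-assoc b a (ℚ.- a) ⟩
    b ℚ.+ (a ℚ.- a)    ≡⟨ cong (b ℚ.+_) (ℚ.+-inverseʳ a) ⟩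
    b ℚ.+ 0ℚ           ≡⟨ ℚ.+-identityʳ b ⟩
    b                  ∎
    where open ≡-Reasoning
  cancel : ∀ a b → a ℚ.+ (b ℚ.- a) ≡ b
  cancel a b = trans (sym (ℚ.+-assoc a b (ℚ.- a))) (cancel′ a b)

  below′ : ℚ → Set
  below′ q = ∃[ r ] ∃[ s ] (below x r × below y s × q ≡ r ℚ.+ s)

  lower′ : ∀ {p q} → p ℚ.< q → below′ q → below′ p
  lower′ {p} p<q (r , s , r<x , s<y , refl) =
    r , p ℚ.- r , r<x
    , lower y (subst (p ℚ.- r ℚ.<_) (cancel′ r s) (ℚ.+-monoˡ-< (ℚ.- r) p<q)) s<y
    , sym (cancel r p)

  rounded′ : ∀ {q} → below′ q → ∃[ r ] (q ℚ.< r × below′ r)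
  rounded′ (r , s , r<x , s<y , refl) =
    let r′ , r<r′ , r′<x = rounded x r<x
    in r′ ℚ.+ s , ℚ.+-monoˡ-< s r<r′ , r′ , s , r′<x , s<y , refl

partialSum : (ℕ → ℝ≥0∞) → ℕ → ℝ≥0∞
partialSum x zero    = fromℚ 0ℚ
partialSum x (suc n) = partialSum x n + x n

sup : (ℕ → ℝ≥0∞) → ℝ≥0∞
sup x = record
  { below    = λ q → ∃[ n ] below (x n) q
  ; negative = λ q<0 → 0 , negative (x 0) q<0
  ; lower    = λ p<q (n , q<xₙ) → n , lower (x n) p<q q<xₙ
  ; rounded  = λ (n , q<xₙ) →
      let r , q<r , r<xₙ = rounded (x n) q<xₙ in r , q<r , n , r<xₙ
  }

-- The terms are non-negative, so the series is the supremum of its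
-- partial sums.
∑ : (ℕ → ℝ≥0∞) → ℝ≥0∞
∑ x = sup (partialSum x)

record BorelMeasure : Set₁ where
  field
    measure      : BorelSet → ℝ≥0∞
    measure-cong : ∀ {A B} → set A ≐ set B → measure A ≈ measure B
    measure-∅    : measure ∅ᴮ ≈ fromℚ 0ℚ
    measure-⋃    : (A : ℕ → BorelSet) →
                   (∀ i j → i ≢ j → set (A i) ⊥ set (A j)) →
                   measure (⋃ᴮ A) ≈ ∑ (λ n → measure (A n))

open BorelMeasure public

2^-_ : ℕ → ℚ
2^- n = (+ 1 ℚ./ (2 ℕ.^ n)) {{ℕ.m^n≢0 2 n}}

2^-_≥0 : ∀ n → NonNegative (2^- n)
2^- n ≥0 = ℚ.normalize-nonNeg 1 (2 ℕ.^ n) {{ℕ.m^n≢0 2 n}}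

2⁻ : ℕ → ℝ≥0∞
2⁻ n = fromℚ (2^- n) {{2^- n ≥0}}

-- Classically, exactly one Borel measure (up to ≈) satisfies this.
IsCoinTossing : BorelMeasure → Set
IsCoinTossing μ = ∀ σ → measure μ (Nᴮ σ) ≈ 2⁻ (length σ)

triangle : ℕ → ℕ
triangle zero    = 0
triangle (suc n) = suc n ℕ.+ triangle n

-- Cantor's pairing function; `unpair` is its inverse.
⟨_,_⟩ : ℕ → ℕ → ℕ
⟨ a , b ⟩ = a ℕ.+ triangle (a ℕ.+ b)

-- The successor in the antidiagonal enumeration of ℕ × ℕ.
next : ℕ × ℕ → ℕ × ℕ
next (a , zero)  = 0 , suc a
next (a , suc b) = suc a , b

unpair : ℕ → ℕ × ℕ
unpair zero    = 0 , 0
unpair (suc n) = next (unpair n)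

π₁ π₂ : ℕ → ℕ
π₁ n = proj₁ (unpair n)
π₂ n = proj₂ (unpair n)

pair-next : (p : ℕ × ℕ) →
            ⟨ proj₁ (next p) , proj₂ (next p) ⟩ ≡ suc ⟨ proj₁ p , proj₂ p ⟩
pair-next (a , zero)  = cong (λ c → suc (a ℕ.+ triangle c)) (sym (ℕ.+-identityʳ a))
pair-next (a , suc b) = cong (λ c → suc (a ℕ.+ triangle c)) (sym (ℕ.+-suc a b))

pair-unpair : ∀ n → ⟨ π₁ n , π₂ n ⟩ ≡ n
pair-unpair zero    = refl
pair-unpair (suc n) = trans (pair-next (unpair n)) (cong suc (pair-unpair n))

unpair-pair : ∀ a b → unpair ⟨ a , b ⟩ ≡ (a , b)
unpair-pair a b = go (a ℕ.+ b) a b refl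
  where
  go : ∀ s a b → a ℕ.+ b ≡ s → unpair ⟨ a , b ⟩ ≡ (a , b)
  go s       zero    zero    _    = refl
  go (suc s) zero    (suc b) refl = trans
    (cong unpair (pair-next (b , 0)))
    (cong next (go s b 0 (ℕ.+-identityʳ b)))
  go s       (suc a) b       eq   = trans
    (cong unpair (pair-next (a , suc b)))
    (cong next (go s a (suc b) (trans (ℕ.+-suc a b) eq)))

π₁-pair : ∀ a b → π₁ ⟨ a , b ⟩ ≡ a
π₁-pair a b = cong proj₁ (unpair-pair a b)

π₂-pair : ∀ a b → π₂ ⟨ a , b ⟩ ≡ b
π₂-pair a b = cong proj₂ (unpair-pair a b)

-- Kleene's partial recursive functions relative to an oracle, unary by
-- means of the pairing bijection.
data Code : Set where
  zeroᶜ succᶜ leftᶜ rightᶜ oracleᶜ : Code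
  pairᶜ compᶜ precᶜ                : Code → Code → Code
  minᶜ                             : Code → Code

-- ⟦ p ⟧ X x y: the program p with oracle X halts on x with output y.
⟦_⟧ : Code → Cantor → ℕ → ℕ → Set

PrimRec : Code → Code → Cantor → ℕ → ℕ → ℕ → Set
PrimRec p q X a zero    y = ⟦ p ⟧ X a y
PrimRec p q X a (suc n) y = ∃[ z ] (PrimRec p q X a n z × ⟦ q ⟧ X ⟨ a , ⟨ n , z ⟩ ⟩ y)

⟦ zeroᶜ     ⟧ X x y = y ≡ 0
⟦ succᶜ     ⟧ X x y = y ≡ suc x
⟦ leftᶜ     ⟧ X x y = y ≡ π₁ x
⟦ rightᶜ    ⟧ X x y = y ≡ π₂ x
⟦ oracleᶜ   ⟧ X x y = y ≡ toℕ (X x)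
⟦ pairᶜ p q ⟧ X x y = ∃[ a ] ∃[ b ] (⟦ p ⟧ X x a × ⟦ q ⟧ X x b × y ≡ ⟨ a , b ⟩)
⟦ compᶜ p q ⟧ X x y = ∃[ z ] (⟦ q ⟧ X x z × ⟦ p ⟧ X z y)
⟦ precᶜ p q ⟧ X x y = PrimRec p q X (π₁ x) (π₂ x) y
⟦ minᶜ p    ⟧ X x y = ⟦ p ⟧ X ⟨ x , y ⟩ 0 × (∀ i → i ℕ.< y → ∃[ z ] ⟦ p ⟧ X ⟨ x , i ⟩ (suc z))

⟦⟧-functional : ∀ p X {x y y′} → ⟦ p ⟧ X x y → ⟦ p ⟧ X x y′ → y ≡ y′
⟦⟧-functional zeroᶜ       X refl refl = refl
⟦⟧-functional succᶜ       X refl refl = refl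
⟦⟧-functional leftᶜ       X refl refl = refl
⟦⟧-functional rightᶜ      X refl refl = refl
⟦⟧-functional oracleᶜ     X refl refl = refl
⟦⟧-functional (pairᶜ p q) X (_ , _ , pa , qb , refl) (_ , _ , pa′ , qb′ , refl) =
  cong₂ ⟨_,_⟩ (⟦⟧-functional p X pa pa′) (⟦⟧-functional q X qb qb′)
⟦⟧-functional (compᶜ p q) X (_ , qz , py) (_ , qz′ , py′)
  with refl ← ⟦⟧-functional q X qz qz′ = ⟦⟧-functional p X py py′
⟦⟧-functional (precᶜ p q) X {x} h h′ = go (π₂ x) h h′
  where
  go : ∀ n {y y′} → PrimRec p q X (π₁ x) n y → PrimRec p q X (π₁ x) n y′ → y ≡ y′
  go zero    h            h′             = ⟦⟧-functional p X h h′
  go (suc n) (_ , rz , h) (_ , rz′ , h′)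
    with refl ← go n rz rz′ = ⟦⟧-functional q X h h′
⟦⟧-functional (minᶜ p)    X {y = y} {y′ = y′} (h , before) (h′ , before′) with ℕ.<-cmp y y′
... | tri< y<y′ _ _ = ⊥-elim (ℕ.0≢1+n (⟦⟧-functional p X h (proj₂ (before′ y y<y′))))
... | tri≈ _ y≡y′ _ = y≡y′
... | tri> _ _ y′<y = ⊥-elim (ℕ.0≢1+n (⟦⟧-functional p X h′ (proj₂ (before y′ y′<y))))

gödel : Code → ℕ
gödel zeroᶜ       = ⟨ 0 , 0 ⟩
gödel succᶜ       = ⟨ 1 , 0 ⟩
gödel leftᶜ       = ⟨ 2 , 0 ⟩
gödel rightᶜ      = ⟨ 3 , 0 ⟩
gödel oracleᶜ     = ⟨ 4 , 0 ⟩
gödel (pairᶜ p q) = ⟨ 5 , ⟨ gödel p , gödel q ⟩ ⟩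
gödel (compᶜ p q) = ⟨ 6 , ⟨ gödel p , gödel q ⟩ ⟩
gödel (precᶜ p q) = ⟨ 7 , ⟨ gödel p , gödel q ⟩ ⟩
gödel (minᶜ p)    = ⟨ 8 , gödel p ⟩

gödel-injective : ∀ {p q} → gödel p ≡ gödel q → p ≡ q
gödel-injective {p} {q} eq = begin
  p                                ≡⟨ sym (decode-gödel p (ℕ.m≤m⊔n (depth p) (depth q))) ⟩
  decode (depth p ℕ.⊔ depth q) (gödel p) ≡⟨ cong (decode (depth p ℕ.⊔ depth q)) eq ⟩
  decode (depth p ℕ.⊔ depth q) (gödel q) ≡⟨ decode-gödel q (ℕ.m≤n⊔m (depth p) (depth q)) ⟩
  q                                ∎
  where
  open ≡-Reasoning

  build : ℕ → Code → Code → Code → Code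
  build 0 p q r = zeroᶜ
  build 1 p q r = succᶜ
  build 2 p q r = leftᶜ
  build 3 p q r = rightᶜ
  build 4 p q r = oracleᶜ
  build 5 p q r = pairᶜ p q
  build 6 p q r = compᶜ p q
  build 7 p q r = precᶜ p q
  build _ p q r = minᶜ r

  -- The first argument bounds the depth of recursion.
  decode : ℕ → ℕ → Code
  decode zero    n = zeroᶜ
  decode (suc k) n =
    build (π₁ n) (decode k (π₁ (π₂ n))) (decode k (π₂ (π₂ n))) (decode k (π₂ n))

  depth : Code → ℕ
  depth (pairᶜ p q) = suc (depth p ℕ.⊔ depth q)
  depth (compᶜ p q) = suc (depth p ℕ.⊔ depth q)
  depth (precᶜ p q) = suc (depth p ℕ.⊔ depth q)
  depth (minᶜ p)    = suc (depth p)
  depth _           = 1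

  decode-pair : ∀ k t m → decode (suc k) ⟨ t , m ⟩ ≡
                build t (decode k (π₁ m)) (decode k (π₂ m)) (decode k m)
  decode-pair k t m rewrite unpair-pair t m = refl

  decode-gödel : ∀ p {k} → depth p ℕ.≤ k → decode k (gödel p) ≡ p

  decode-node : ∀ p q t {k} → depth p ℕ.⊔ depth q ℕ.≤ k →
                decode (suc k) ⟨ t , ⟨ gödel p , gödel q ⟩ ⟩ ≡
                build t p q (decode k ⟨ gödel p , gödel q ⟩)
  decode-node p q t {k} d
    rewrite decode-pair k t ⟨ gödel p , gödel q ⟩ | unpair-pair (gödel p) (gödel q)
          | decode-gödel p (ℕ.m⊔n≤o⇒m≤o (depth p) (depth q) d)
          | decode-gödel q (ℕ.m⊔n≤o⇒n≤o (depth p) (depth q) d) = refl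

  decode-gödel zeroᶜ       {suc k} _         = decode-pair k 0 0
  decode-gödel succᶜ       {suc k} _         = decode-pair k 1 0
  decode-gödel leftᶜ       {suc k} _         = decode-pair k 2 0
  decode-gödel rightᶜ      {suc k} _         = decode-pair k 3 0
  decode-gödel oracleᶜ     {suc k} _         = decode-pair k 4 0
  decode-gödel (pairᶜ p q) {suc k} (ℕ.s≤s d) = decode-node p q 5 d
  decode-gödel (compᶜ p q) {suc k} (ℕ.s≤s d) = decode-node p q 6 d
  decode-gödel (precᶜ p q) {suc k} (ℕ.s≤s d) = decode-node p q 7 d
  decode-gödel (minᶜ p)    {suc k} (ℕ.s≤s d) =
    trans (decode-pair k 8 (gödel p)) (cong minᶜ (decode-gödel p d))

-- φ e X x y: the computation φₑˣ(x) halts with output y.  A number that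
-- is not the Gödel number of a program indexes the empty function.
φ : ℕ → Cantor → ℕ → ℕ → Set
φ e X x y = ∃[ p ] (gödel p ≡ e × ⟦ p ⟧ X x y)

-- Computability without an oracle is computability from the zero oracle.
Recursive : (ℕ → ℕ) → Set
Recursive f = ∃[ e ] ∀ n → φ e (λ _ → Fin.zero) n (f n)

S : ℕ → Pred Cantor 0ℓ
S e X = ∃[ y ] φ e X 0 y

UniformlyΣ⁰₁ : (ℕ → Pred Cantor 0ℓ) → Set
UniformlyΣ⁰₁ V = ∃[ f ] (Recursive f × ∀ n → V n ≐ S (f n))

-- Every S e is open, hence Borel, so taking the V n among the Borel sets
-- (which makes their measures available) is no restriction.
EffectivelyNull : BorelMeasure → Pred Cantor 0ℓ → Set₁
EffectivelyNull μ A =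
  Σ[ V ∈ (ℕ → BorelSet) ]
    ( UniformlyΣ⁰₁ (λ n → set (V n))
    × (∀ n → measure μ (V n) ≤ 2⁻ n)
    × (∀ n → A ⊆ set (V n)) )

Random : BorelMeasure → Cantor → Set₁
Random μ X = ¬ (Σ[ A ∈ Pred Cantor 0ℓ ] (EffectivelyNull μ A × X ∈ A))

digitSum : Cantor → ℕ → ℕ
digitSum X zero    = 0
digitSum X (suc n) = digitSum X n ℕ.+ toℕ (X n)

average : Cantor → ∀ n → .{{NonZero n}} → ℚ
average X n = + digitSum X n ℚ./ n

-- Convergence of a sequence of rationals, indexed by the positive
-- integers, to a rational limit: rational ε suffice.
infix 4 _⟶_

_⟶_ : (∀ n → .{{NonZero n}} → ℚ) → ℚ → Set
a ⟶ l = ∀ ε → 0ℚ ℚ.< ε → ∃[ n₀ ] ∀ n → .{{_ : NonZero n}} → n₀ ℕ.≤ n → ℚ.∣ a n ℚ.- l ∣ ℚ.< ε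

{-# OPTIONS --safe #-}

-- Bet on the bits of X with integer stakes: starting from capital 1, multiply
-- the capital by p / k = (k + 1) / k on one of the two symbols and by
-- q / k = (k - 1) / k on the other.  The capital is a martingale, so by Ville's
-- inequality the set of sequences along which it ever reaches 2 ^ m has measure
-- at most 2 ^ (- m); these sets are uniformly Σ⁰₁, hence a random X keeps the
-- capital bounded.  But if the favoured symbol has frequency at least
-- 1/2 + 1/(2k) in X at stage n, the 2k-th power of the capital is at least
-- (p ^ (k + 1) q ^ (k - 1) / k ^ (2k)) ^ n, and the base exceeds 1.  Hence each
-- symbol eventually has frequency below 1/2 + 1/(2k).
module Submission where

open import Algebra.Bundles using (CommutativeMonoid)
import Algebra.Properties.AbelianGroup as AbelianGroupProperties
import Algebra.Properties.CommutativeSemigroup as CommutativeSemigroupProperties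
open import Axiom.ExcludedMiddle using (ExcludedMiddle)
open import Data.Bool.Base using (if_then_else_)
open import Data.Fin.Base using (Fin; zero; suc; toℕ; opposite)
open import Data.Fin.Properties using (0≢1+n)
open import Data.Integer.Base as ℤ using (+_; -[1+_]; +<+)
import Data.Integer.Properties as ℤ
open import Data.List.Base using (List; []; _∷_; _∷ʳ_; length; map; applyUpTo)
open import Data.List.Properties using (applyUpTo-∷ʳ; length-applyUpTo; map-++; length-++-sucʳ; ++-identityʳ)
open import Data.Nat.Base as ℕ using (ℕ; zero; suc; pred; NonZero; _*_; _∸_; _^_)
open import Data.Nat.ListAction using (product)
open import Data.Nat.ListAction.Properties using (product-++)
import Data.Nat.Properties as ℕ
open import Data.Nat.Tactic.RingSolver using (solve-∀)
open import Data.Product.Base using (∃-syntax; _×_; _,_; proj₁; proj₂)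
open import Data.Rational.Base as ℚ using (ℚ; mkℚ; 0ℚ; 1ℚ)
open import Data.Rational.Base using (½)
import Data.Rational.Properties as ℚ
import Data.Rational.Unnormalised.Base as ℚᵘ
import Data.Rational.Unnormalised.Properties as ℚᵘ
open import Data.Sum.Base using (inj₁; inj₂)
open import Function.Base using (_∘_; case_of_; id)
open import Level using (0ℓ)
open import Relation.Binary.PropositionalEquality
open import Relation.Nullary using (¬_; yes; no; does; contradiction)
open import Relation.Unary using (Pred; Decidable; _∈_; _⊆_; _≐_; _⊥_)
open import Defs

open AbelianGroupProperties ℚ.+-0-abelianGroup using (xyx⁻¹≈y; inverseˡ-unique)
open CommutativeSemigroupProperties
  (CommutativeMonoid.commutativeSemigroup ℚ.+-0-commutativeMonoid) using (interchange)

-- Relative computability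

natrec : ℕ → (ℕ → ℕ → ℕ) → ℕ → ℕ
natrec b s zero    = b
natrec b s (suc n) = s n (natrec b s n)

-- One code has to serve every oracle, so that halting of a search through `F` is a property of the
-- oracle alone.
Computable : (Cantor → ℕ → ℕ) → Set
Computable F = ∃[ c ] ∀ X x → ⟦ c ⟧ X x (F X x)

private variable
  F G H : Cantor → ℕ → ℕ

≡-computable : (∀ X x → F X x ≡ G X x) → Computable F → Computable G
≡-computable eq (c , h) = c , λ X x → subst (⟦ c ⟧ X x) (eq X x) (h X x)

constᶜ : ℕ → Code
constᶜ zero    = zeroᶜ
constᶜ (suc n) = compᶜ succᶜ (constᶜ n)

⟦constᶜ⟧ : ∀ n X x → ⟦ constᶜ n ⟧ X x n
⟦constᶜ⟧ zero    X x = refl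
⟦constᶜ⟧ (suc n) X x = n , ⟦constᶜ⟧ n X x , refl

const-computable : ∀ n → Computable (λ X x → n)
const-computable n = constᶜ n , ⟦constᶜ⟧ n

pair-computable : Computable F → Computable G → Computable (λ X x → ⟨ F X x , G X x ⟩)
pair-computable (c , h) (c′ , h′) = pairᶜ c c′ , λ X x → _ , _ , h X x , h′ X x , refl

∘-computable : Computable F → Computable G → Computable (λ X x → F X (G X x))
∘-computable (c , h) (c′ , h′) = compᶜ c c′ , λ X x → _ , h′ X x , h X _

-- No constructor of `Code` is the identity; re-pairing the two projections of the input supplies
-- it.
id-computable : Computable (λ X x → x)
id-computable =
  ≡-computable (λ X x → pair-unpair x)
    (pair-computable (leftᶜ , λ X x → refl) (rightᶜ , λ X x → refl))

suc-computable : Computable F → Computable (λ X x → suc (F X x))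
suc-computable = ∘-computable (succᶜ , λ X x → refl)

π₁-computable : Computable F → Computable (λ X x → π₁ (F X x))
π₁-computable = ∘-computable (leftᶜ , λ X x → refl)

π₂-computable : Computable F → Computable (λ X x → π₂ (F X x))
π₂-computable = ∘-computable (rightᶜ , λ X x → refl)

oracle-computable : Computable F → Computable (λ X x → toℕ (X (F X x)))
oracle-computable = ∘-computable (oracleᶜ , λ X x → refl)

-- `precᶜ` expects parameter and recursion length as one pair, so the input `x` is first paired with
-- `G X x`. The step sees `⟨ a , ⟨ n , z ⟩ ⟩`: the original input, the stage and the previous value.
natrec-computable : {step : Cantor → ℕ → ℕ → ℕ → ℕ} →
  Computable F →
  Computable (λ X y → step X (π₁ y) (π₁ (π₂ y)) (π₂ (π₂ y))) →
  Computable G →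
  Computable (λ X x → natrec (F X x) (step X x) (G X x))
natrec-computable {F} {G} {step} (b , hb) (s , hs) computable-G =
  ≡-computable
    (λ X x → cong₂ (λ a n → natrec (F X a) (step X a) n) (π₁-pair x (G X x)) (π₂-pair x (G X x)))
    (∘-computable {F = λ X y → natrec (F X (π₁ y)) (step X (π₁ y)) (π₂ y)}
      (precᶜ b s , λ X y → unfold X (π₁ y) (π₂ y))
      (pair-computable id-computable computable-G))
  where
  step-pair : ∀ X a n z →
    step X (π₁ ⟨ a , ⟨ n , z ⟩ ⟩) (π₁ (π₂ ⟨ a , ⟨ n , z ⟩ ⟩)) (π₂ (π₂ ⟨ a , ⟨ n , z ⟩ ⟩)) ≡ step X a n z
  step-pair X a n z
    rewrite unpair-pair a ⟨ n , z ⟩ | unpair-pair n z = refl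

  unfold : ∀ X a n → PrimRec b s X a n (natrec (F X a) (step X a) n)
  unfold X a zero    = hb X a
  unfold X a (suc n) = _ , unfold X a n ,
    subst (⟦ s ⟧ X _) (step-pair X a n _) (hs X ⟨ a , ⟨ n , _ ⟩ ⟩)

*-computable : Computable F → Computable G → Computable (λ X x → F X x * G X x)
*-computable {F} {G} cF cG =
  ≡-computable (λ X x → natrec-* (F X x) (G X x))
    (natrec-computable (const-computable 0)
      (+-computable (∘-computable cG (π₁-computable id-computable)) (π₂-computable (π₂-computable id-computable)))
      cF)
  where
  natrec-+ : ∀ m n → natrec m (λ _ → suc) n ≡ n ℕ.+ m
  natrec-+ m zero    = refl
  natrec-+ m (suc n) = cong suc (natrec-+ m n)

  +-computable : ∀ {F G} → Computable F → Computable G → Computable (λ X x → F X x ℕ.+ G X x)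
  +-computable {F} {G} cF cG =
    ≡-computable (λ X x → natrec-+ (G X x) (F X x))
      (natrec-computable cG (suc-computable (π₂-computable (π₂-computable id-computable))) cF)

  natrec-* : ∀ m n → natrec 0 (λ _ → n ℕ.+_) m ≡ m * n
  natrec-* zero    n = refl
  natrec-* (suc m) n = cong (n ℕ.+_) (natrec-* m n)

^-computable : Computable F → Computable G → Computable (λ X x → F X x ^ G X x)
^-computable {F} {G} cF cG =
  ≡-computable (λ X x → natrec-^ (F X x) (G X x))
    (natrec-computable (const-computable 1)
      (*-computable (∘-computable cF (π₁-computable id-computable)) (π₂-computable (π₂-computable id-computable)))
      cG)
  where
  natrec-^ : ∀ m n → natrec 1 (λ _ → m *_) n ≡ m ^ n
  natrec-^ m zero    = refl
  natrec-^ m (suc n) = cong (m *_) (natrec-^ m n)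

∸-computable : Computable F → Computable G → Computable (λ X x → F X x ∸ G X x)
∸-computable {F} {G} cF cG =
  ≡-computable (λ X x → natrec-∸ (F X x) (G X x))
    (natrec-computable cF (pred-computable (π₂-computable (π₂-computable id-computable))) cG)
  where
  -- The predecessor is a recursion that discards the previous value and returns the stage.
  natrec-pred : ∀ n → natrec 0 (λ m _ → m) n ≡ pred n
  natrec-pred zero    = refl
  natrec-pred (suc n) = refl

  pred-computable : ∀ {F} → Computable F → Computable (λ X x → pred (F X x))
  pred-computable {F} cF =
    ≡-computable (λ X x → natrec-pred (F X x))
      (natrec-computable (const-computable 0) (π₁-computable (π₂-computable id-computable)) cF)

  natrec-∸ : ∀ m n → natrec m (λ _ → pred) n ≡ m ∸ n
  natrec-∸ m zero    = refl
  natrec-∸ m (suc n) = trans (cong pred (natrec-∸ m n)) (ℕ.pred[m∸n]≡m∸[1+n] m n)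

-- The index of the m-th set codes `compᶜ c (constᶜ m)`, where the program c
-- searches for a zero of F ⟨ m , _ ⟩.
module _ {F : Cantor → ℕ → ℕ} (computable-F : Computable F) where

  private
    search : Code
    search = minᶜ (proj₁ computable-F)

    -- Minimisation halts at the least zero, which may precede the known zero `n`. The search moves
    -- up from `i` with `k` candidates left before `n`, recording in `before` that all earlier
    -- values are positive.
    search-halts : ∀ {X m n} → F X ⟨ m , n ⟩ ≡ 0 → ∃[ y ] ⟦ search ⟧ X m y
    search-halts {X} {m} {n} Fn≡0 = go n 0 (ℕ.+-identityʳ n) (λ _ ())
      where
      code = proj₁ computable-F

      run : ∀ {y z} → F X ⟨ m , y ⟩ ≡ z → ⟦ code ⟧ X ⟨ m , y ⟩ z
      run eq = subst (⟦ code ⟧ X _) eq (proj₂ computable-F X _)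

      go : ∀ k i → k ℕ.+ i ≡ n → (∀ j → j ℕ.< i → ∃[ z ] ⟦ code ⟧ X ⟨ m , j ⟩ (suc z)) →
           ∃[ y ] ⟦ search ⟧ X m y
      go zero    i refl before = i , run Fn≡0 , before
      go (suc k) i k+i≡n before with F X ⟨ m , i ⟩ in eq
      ... | zero  = i , run eq , before
      ... | suc z = go k (suc i) (trans (ℕ.+-suc k i) k+i≡n) λ j j<1+i → case ℕ.m<1+n⇒m<n∨m≡n j<1+i of λ where
              (inj₁ j<i)  → before j j<i
              (inj₂ refl) → z , run eq

    index : ℕ → ℕ
    index m = ⟨ 6 , ⟨ gödel search , gödel (constᶜ m) ⟩ ⟩

    -- Here 6 is the tag of `compᶜ`, 2 is the value of `⟨ 1 , 0 ⟩`, the number of `succᶜ`, and 0 is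
    -- the number of `zeroᶜ`.
    natrec-gödel : ∀ m → natrec 0 (λ _ z → ⟨ 6 , ⟨ 2 , z ⟩ ⟩) m ≡ gödel (constᶜ m)
    natrec-gödel zero    = refl
    natrec-gödel (suc m) = cong (λ z → ⟨ 6 , ⟨ 2 , z ⟩ ⟩) (natrec-gödel m)

    index-computable : Computable (λ X → index)
    index-computable =
      pair-computable (const-computable 6) (pair-computable (const-computable (gödel search))
        (≡-computable (λ X → natrec-gödel)
          (natrec-computable (const-computable 0)
            (pair-computable (const-computable 6) (pair-computable (const-computable 2)
              (π₂-computable (π₂-computable id-computable))))
            id-computable)))

  zero-search-uniformlyΣ⁰₁ : (V : ℕ → Pred Cantor 0ℓ) →
    (∀ m → V m ≐ λ X → ∃[ n ] F X ⟨ m , n ⟩ ≡ 0) → UniformlyΣ⁰₁ V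
  zero-search-uniformlyΣ⁰₁ V V≐ =
    index
    , (gödel (proj₁ index-computable) , λ n → proj₁ index-computable , refl , proj₂ index-computable _ n)
    , λ m → to m , from m
    where
    to : ∀ m {X} → X ∈ V m → X ∈ S (index m)
    to m {X} X∈V =
      let n , Fn≡0 = proj₁ (V≐ m) X∈V
          y , h    = search-halts {m = m} {n} Fn≡0
      in y , compᶜ search (constᶜ m) , refl , m , ⟦constᶜ⟧ m X 0 , h

    from : ∀ m {X} → X ∈ S (index m) → X ∈ V m
    -- The index determines its program, and determinism forces the constant subprogram to output
    -- `m`; the output of the search is then a zero of `F`.
    from m {X} (y , p , eq , h) with refl ← gödel-injective {p} {compᶜ search (constᶜ m)} eq
      with z , hz , halts , _ ← h
      with refl ← ⟦⟧-functional (constᶜ m) X hz (⟦constᶜ⟧ m X 0) =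
      proj₂ (V≐ m) (y , ⟦⟧-functional (proj₁ computable-F) X (proj₂ computable-F X _) halts)

-- Ville's inequality

length-∷ʳ : ∀ {A : Set} (xs : List A) x → length (xs ∷ʳ x) ≡ suc (length xs)
length-∷ʳ xs x = trans (length-++-sucʳ xs x []) (cong (suc ∘ length) (++-identityʳ xs))

N-∷ʳ⁺ : ∀ σ {b} Y → Y ∈ N σ → Y (length σ) ≡ b → Y ∈ N (σ ∷ʳ b)
N-∷ʳ⁺ []      Y Y∈N eq zero    = eq
N-∷ʳ⁺ (_ ∷ σ) Y Y∈N eq zero    = Y∈N zero
N-∷ʳ⁺ (_ ∷ σ) Y Y∈N eq (suc i) = N-∷ʳ⁺ σ (Y ∘ suc) (Y∈N ∘ suc) eq i

N-∷ʳ⁻ : ∀ σ {b} Y → Y ∈ N (σ ∷ʳ b) → Y ∈ N σ × Y (length σ) ≡ b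
N-∷ʳ⁻ []      Y Y∈N = (λ ()) , Y∈N zero
N-∷ʳ⁻ (_ ∷ σ) Y Y∈N =
  let Y∈Nσ , eq = N-∷ʳ⁻ σ (Y ∘ suc) (Y∈N ∘ suc)
  in (λ { zero → Y∈N zero ; (suc i) → Y∈Nσ i }) , eq

applyUpTo-N : ∀ σ Y → Y ∈ N σ → applyUpTo Y (length σ) ≡ σ
applyUpTo-N []      Y Y∈N = refl
applyUpTo-N (_ ∷ σ) Y Y∈N = cong₂ _∷_ (Y∈N zero) (applyUpTo-N σ (Y ∘ suc) (Y∈N ∘ suc))

-- Rational upper bounds on measures

sum : (ℕ → ℚ) → ℕ → ℚ
sum f zero    = 0ℚ
sum f (suc n) = sum f n ℚ.+ f n

sum-0 : ∀ n → sum (λ _ → 0ℚ) n ≡ 0ℚ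
sum-0 zero    = refl
sum-0 (suc n) = trans (ℚ.+-identityʳ _) (sum-0 n)

sum-suc : ∀ f n → sum f (suc n) ≡ f 0 ℚ.+ sum (f ∘ suc) n
sum-suc f zero    = ℚ.+-comm 0ℚ (f 0)
sum-suc f (suc n) = trans (cong (ℚ._+ f (suc n)) (sum-suc f n)) (ℚ.+-assoc (f 0) _ _)

sum-+ : ∀ f g n → sum (λ k → f k ℚ.+ g k) n ≡ sum f n ℚ.+ sum g n
sum-+ f g zero    = refl
sum-+ f g (suc n) = trans (cong (ℚ._+ (f n ℚ.+ g n)) (sum-+ f g n)) (interchange (sum f n) (sum g n) (f n) (g n))

infix 4 _⊑_

-- This is `x ≤ fromℚ q` unfolded, without carrying a proof that `q` is non-negative.
_⊑_ : ℝ≥0∞ → ℚ → Set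
x ⊑ q = ∀ {r} → below x r → r ℚ.< q

partialSum-⊑ : ∀ x u → (∀ n → x n ⊑ u n) → ∀ n → partialSum x n ⊑ sum u n
partialSum-⊑ x u x⊑u zero    r<0 = r<0
partialSum-⊑ x u x⊑u (suc n) (_ , _ , r , s , refl) =
  ℚ.+-mono-< (partialSum-⊑ x u x⊑u n r) (x⊑u n s)

-- Additivity of a measure is stated for sequences, so the two sets are padded with empty ones.
children : (Fin 2 → BorelSet) → ℕ → BorelSet
children A 0             = A zero
children A 1             = A (suc zero)
children A (suc (suc _)) = ∅ᴮ

module Ville (μ : BorelMeasure) (coin : IsCoinTossing μ) where

  ∅-⊑ : measure μ ∅ᴮ ⊑ 0ℚ
  ∅-⊑ = proj₁ (measure-∅ μ)

  -- A rational below a series is already below one of its partial sums, so a uniform bound on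
  -- finite sums suffices.
  ⋃-⊑ : ∀ A (u : ℕ → ℚ) {q} → (∀ i j → i ≢ j → set (A i) ⊥ set (A j)) →
        (∀ n → measure μ (A n) ⊑ u n) → (∀ n → sum u n ℚ.≤ q) → measure μ (⋃ᴮ A) ⊑ q
  ⋃-⊑ A u disjoint bound sum≤q below =
    let n , below-n = proj₁ (measure-⋃ μ A disjoint) below
    in ℚ.<-≤-trans (partialSum-⊑ _ u bound n below-n) (sum≤q n)

  children-⊑ : ∀ A {p q} → set (A zero) ⊥ set (A (suc zero)) → 0ℚ ℚ.≤ p → 0ℚ ℚ.≤ q →
               measure μ (A zero) ⊑ p → measure μ (A (suc zero)) ⊑ q →
               measure μ (⋃ᴮ (children A)) ⊑ p ℚ.+ q
  children-⊑ A {p} {q} disjoint 0≤p 0≤q bound₀ bound₁ = ⋃-⊑ (children A) u disjoint′ bound sum≤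
    where
    u : ℕ → ℚ
    u 0             = p
    u 1             = q
    u (suc (suc _)) = 0ℚ

    disjoint′ : ∀ i j → i ≢ j → set (children A i) ⊥ set (children A j)
    disjoint′ 0             0             i≢j _       = i≢j refl
    disjoint′ 0             1             i≢j         = disjoint
    disjoint′ 0             (suc (suc j)) i≢j (_ , ())
    disjoint′ 1             0             i≢j (y , z) = disjoint (z , y)
    disjoint′ 1             1             i≢j _       = i≢j refl
    disjoint′ 1             (suc (suc j)) i≢j (_ , ())
    disjoint′ (suc (suc i)) j             i≢j (() , _)

    bound : ∀ n → measure μ (children A n) ⊑ u n
    bound 0             = bound₀
    bound 1             = bound₁
    bound (suc (suc n)) = ∅-⊑

    sum-2+n : ∀ n → sum u (suc (suc n)) ≡ p ℚ.+ q
    sum-2+n zero    = cong (ℚ._+ q) (ℚ.+-identityˡ p)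
    sum-2+n (suc n) = trans (ℚ.+-identityʳ _) (sum-2+n n)

    sum≤ : ∀ n → sum u n ℚ.≤ p ℚ.+ q
    sum≤ 0             = ℚ.+-mono-≤ 0≤p 0≤q
    sum≤ 1             = subst (ℚ._≤ p ℚ.+ q) (ℚ.+-comm p 0ℚ) (ℚ.+-monoʳ-≤ p 0≤q)
    sum≤ (suc (suc n)) = ℚ.≤-reflexive (sum-2+n n)

  module _ {P : Pred (List (Fin 2)) 0ℓ} (P? : Decidable P) where

    -- The Y ∈ N σ for which, among the initial segments of Y of length
    -- at least |σ|, the first one satisfying P has length |σ| + k.
    firstHit : List (Fin 2) → ℕ → BorelSet
    firstHit σ zero    = if does (P? σ) then Nᴮ σ else ∅ᴮ
    firstHit σ (suc k) = if does (P? σ) then ∅ᴮ else ⋃ᴮ (children λ b → firstHit (σ ∷ʳ b) k)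

    everHit : BorelSet
    everHit = ⋃ᴮ (firstHit [])

    ∈-children⁻ : ∀ A {Y} → Y ∈ set (⋃ᴮ (children A)) → ∃[ b ] Y ∈ set (A b)
    ∈-children⁻ A (0 , Y∈A)           = zero , Y∈A
    ∈-children⁻ A (1 , Y∈A)           = suc zero , Y∈A
    ∈-children⁻ A (suc (suc _) , ())

    ∈-children⁺ : ∀ A b {Y} → Y ∈ set (A b) → Y ∈ set (⋃ᴮ (children A))
    ∈-children⁺ A zero       Y∈A = 0 , Y∈A
    ∈-children⁺ A (suc zero) Y∈A = 1 , Y∈A

    firstHit⊆N : ∀ σ k → set (firstHit σ k) ⊆ N σ
    firstHit⊆N σ zero Y∈ with P? σ
    ... | yes _ = Y∈
    firstHit⊆N σ (suc k) {Y} Y∈ with P? σ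
    ... | no _ = let b , Y∈b = ∈-children⁻ _ Y∈ in proj₁ (N-∷ʳ⁻ σ Y (firstHit⊆N (σ ∷ʳ b) k Y∈b))

    firstHit-bit : ∀ σ k b {Y} → Y ∈ set (firstHit (σ ∷ʳ b) k) → Y (length σ) ≡ b
    firstHit-bit σ k b {Y} Y∈ = proj₂ (N-∷ʳ⁻ σ Y (firstHit⊆N (σ ∷ʳ b) k Y∈))

    -- If `σ` satisfies `P`, only stage 0 is inhabited; otherwise stage 0 is empty, and for two
    -- later stages the bit of `Y` at position `length σ` forces the same child, to which induction
    -- applies.
    firstHit-disjoint : ∀ σ i j → i ≢ j → set (firstHit σ i) ⊥ set (firstHit σ j)
    firstHit-disjoint σ zero    zero    i≢j _ = i≢j refl
    firstHit-disjoint σ zero    (suc j) i≢j (Y∈ , Y∈′) with P? σ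
    firstHit-disjoint σ zero    (suc j) i≢j (Y∈ , ()) | yes _
    firstHit-disjoint σ zero    (suc j) i≢j (() , Y∈′) | no _
    firstHit-disjoint σ (suc i) zero    i≢j (Y∈ , Y∈′) with P? σ
    firstHit-disjoint σ (suc i) zero    i≢j (() , Y∈′) | yes _
    firstHit-disjoint σ (suc i) zero    i≢j (Y∈ , ()) | no _
    firstHit-disjoint σ (suc i) (suc j) i≢j (Y∈ , Y∈′) with P? σ
    ... | no _ with ∈-children⁻ (λ b → firstHit (σ ∷ʳ b) i) Y∈ | ∈-children⁻ (λ b → firstHit (σ ∷ʳ b) j) Y∈′
    ... | b , Y∈b | b′ , Y∈b′ with trans (sym (firstHit-bit σ i b Y∈b)) (firstHit-bit σ j b′ Y∈b′)
    ... | refl = firstHit-disjoint (σ ∷ʳ b) i j (i≢j ∘ cong suc) (Y∈b , Y∈b′)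

    firstHit⇒P : ∀ σ k {Y} → Y ∈ set (firstHit σ k) → ∃[ n ] P (applyUpTo Y n)
    firstHit⇒P σ zero Y∈ with P? σ
    ... | yes Pσ = length σ , subst P (sym (applyUpTo-N σ _ Y∈)) Pσ
    firstHit⇒P σ (suc k) Y∈ with P? σ
    ... | no _ = let b , Y∈b = ∈-children⁻ _ Y∈ in firstHit⇒P (σ ∷ʳ b) k Y∈b

    P⇒firstHit : ∀ σ n {Y} → Y ∈ N σ → P (applyUpTo Y (n ℕ.+ length σ)) →
                 ∃[ k ] Y ∈ set (firstHit σ k)
    P⇒firstHit σ n Y∈ PY with P? σ in eq
    -- `firstHit σ k` unfolds only once `k` is chosen, so the outcome of `P? σ` is transported along
    -- `eq`.
    P⇒firstHit σ n Y∈ PY | yes _ = 0 , subst (λ P?σ → _ ∈ set (if does P?σ then Nᴮ σ else ∅ᴮ)) (sym eq) Y∈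
    P⇒firstHit σ zero Y∈ PY | no ¬P = contradiction (subst P (applyUpTo-N σ _ Y∈) PY) ¬P
    P⇒firstHit σ (suc n) {Y} Y∈ PY | no ¬P =
      let b = Y (length σ)
          k , Y∈′ = P⇒firstHit (σ ∷ʳ b) n (N-∷ʳ⁺ σ Y Y∈ refl)
                      (subst (P ∘ applyUpTo Y)
                        (sym (trans (cong (n ℕ.+_) (length-∷ʳ σ b)) (ℕ.+-suc n (length σ)))) PY)
      in suc k , subst (λ P?σ → _ ∈ set (if does P?σ then ∅ᴮ else ⋃ᴮ (children λ b → firstHit (σ ∷ʳ b) k)))
                   (sym eq) (∈-children⁺ _ b Y∈′)

    everHit≐ : set everHit ≐ λ Y → ∃[ n ] P (applyUpTo Y n)
    everHit≐ = (λ (k , Y∈) → firstHit⇒P [] k Y∈)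
             , λ {Y} (n , PY) → P⇒firstHit [] n (λ ()) (subst (P ∘ applyUpTo Y) (sym (ℕ.+-identityʳ n)) PY)

    -- The measure of `firstHit σ k` as a rational; only the upper bound `firstHit-⊑` is proved.
    mass : List (Fin 2) → ℕ → ℚ
    mass σ zero    = if does (P? σ) then 2^- (length σ) else 0ℚ
    mass σ (suc k) = if does (P? σ) then 0ℚ else mass (σ ∷ʳ zero) k ℚ.+ mass (σ ∷ʳ suc zero) k

    mass-nonNeg : ∀ σ k → 0ℚ ℚ.≤ mass σ k
    mass-nonNeg σ zero with P? σ
    ... | yes _ = ℚ.nonNegative⁻¹ (2^- (length σ)) {{2^- (length σ) ≥0}}
    ... | no _  = ℚ.≤-refl
    mass-nonNeg σ (suc k) with P? σ
    ... | yes _ = ℚ.≤-refl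
    ... | no _  = ℚ.+-mono-≤ (mass-nonNeg (σ ∷ʳ zero) k) (mass-nonNeg (σ ∷ʳ suc zero) k)

    firstHit-⊑ : ∀ σ k → measure μ (firstHit σ k) ⊑ mass σ k
    firstHit-⊑ σ zero with P? σ
    ... | yes _ = proj₁ (coin σ)
    ... | no _  = ∅-⊑
    firstHit-⊑ σ (suc k) with P? σ
    ... | yes _ = ∅-⊑
    ... | no _  = children-⊑ (λ b → firstHit (σ ∷ʳ b) k)
      (λ (Y∈₀ , Y∈₁) → 0≢1+n (trans (sym (firstHit-bit σ k zero Y∈₀)) (firstHit-bit σ k (suc zero) Y∈₁)))
      (mass-nonNeg (σ ∷ʳ zero) k) (mass-nonNeg (σ ∷ʳ suc zero) k)
      (firstHit-⊑ (σ ∷ʳ zero) k) (firstHit-⊑ (σ ∷ʳ suc zero) k)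

    -- Ville's inequality. Think of `v σ` as the capital after `σ` times the measure of `N σ`,
    -- divided by the target capital: the second hypothesis is then the supermartingale property,
    -- and the third says that `P` holds only where the target is reached.
    everHit-⊑ : (v : List (Fin 2) → ℚ) →
                (∀ σ → 0ℚ ℚ.≤ v σ) →
                (∀ σ → v (σ ∷ʳ zero) ℚ.+ v (σ ∷ʳ suc zero) ℚ.≤ v σ) →
                (∀ {σ} → P σ → 2^- (length σ) ℚ.≤ v σ) →
                measure μ everHit ⊑ v []
    everHit-⊑ v v≥0 v-super P⇒v =
      ⋃-⊑ (firstHit []) (mass []) (firstHit-disjoint []) (firstHit-⊑ []) (sum-mass [])
      where
      open ℚ.≤-Reasoning
      -- Induction on the number of stages, for all `σ` at once. If `P σ` holds, only stage 0
      -- contributes; otherwise stage 0 contributes nothing and the later stages split between the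
      -- two children.
      sum-mass : ∀ σ n → sum (mass σ) n ℚ.≤ v σ
      sum-mass σ zero    = v≥0 σ
      sum-mass σ (suc n) rewrite sum-suc (mass σ) n with P? σ
      ... | yes Pσ = begin
        2^- (length σ) ℚ.+ sum (λ _ → 0ℚ) n ≡⟨ cong (2^- (length σ) ℚ.+_) (sum-0 n) ⟩
        2^- (length σ) ℚ.+ 0ℚ               ≡⟨ ℚ.+-identityʳ _ ⟩
        2^- (length σ)                      ≤⟨ P⇒v Pσ ⟩
        v σ                                 ∎
      ... | no _ = begin
        0ℚ ℚ.+ sum (λ k → mass (σ ∷ʳ zero) k ℚ.+ mass (σ ∷ʳ suc zero) k) n ≡⟨ ℚ.+-identityˡ _ ⟩
        sum (λ k → mass (σ ∷ʳ zero) k ℚ.+ mass (σ ∷ʳ suc zero) k) n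
          ≡⟨ sum-+ (mass (σ ∷ʳ zero)) (mass (σ ∷ʳ suc zero)) n ⟩
        sum (mass (σ ∷ʳ zero)) n ℚ.+ sum (mass (σ ∷ʳ suc zero)) n
          ≤⟨ ℚ.+-mono-≤ (sum-mass (σ ∷ʳ zero) n) (sum-mass (σ ∷ʳ suc zero) n) ⟩
        v (σ ∷ʳ zero) ℚ.+ v (σ ∷ʳ suc zero)                                ≤⟨ v-super σ ⟩
        v σ                                                                ∎

-- The betting martingale

toℚᵘ-/ : ∀ a b .{{_ : NonZero b}} → ℚ.toℚᵘ (+ a ℚ./ b) ℚᵘ.≃ + a ℚᵘ./ b
toℚᵘ-/ a (suc b) = ℚ.toℚᵘ-fromℚᵘ (ℚᵘ.mkℚᵘ (+ a) b)

/-mono-≤ : ∀ a b c d .{{_ : NonZero b}} .{{_ : NonZero d}} →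
           a * d ℕ.≤ c * b → + a ℚ./ b ℚ.≤ + c ℚ./ d
/-mono-≤ a b@(suc _) c d@(suc _) ad≤cb = ℚ.toℚᵘ-cancel-≤
  (ℚᵘ.≤-respʳ-≃ (ℚᵘ.≃-sym (toℚᵘ-/ c d)) (ℚᵘ.≤-respˡ-≃ (ℚᵘ.≃-sym (toℚᵘ-/ a b))
    (ℚᵘ.*≤* (subst₂ ℤ._≤_ (ℤ.pos-* a d) (ℤ.pos-* c b) (ℤ.+≤+ ad≤cb)))))

/-mono-< : ∀ a b c d .{{_ : NonZero b}} .{{_ : NonZero d}} →
           a * d ℕ.< c * b → + a ℚ./ b ℚ.< + c ℚ./ d
/-mono-< a b@(suc _) c d@(suc _) ad<cb = ℚ.toℚᵘ-cancel-<
  (ℚᵘ.<-respʳ-≃ (ℚᵘ.≃-sym (toℚᵘ-/ c d)) (ℚᵘ.<-respˡ-≃ (ℚᵘ.≃-sym (toℚᵘ-/ a b))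
    (ℚᵘ.*<* (subst₂ ℤ._<_ (ℤ.pos-* a d) (ℤ.pos-* c b) (ℤ.+<+ ad<cb)))))

/-+ : ∀ a b c d .{{_ : NonZero b}} .{{_ : NonZero d}} →
      + a ℚ./ b ℚ.+ + c ℚ./ d ≡ (+ (a * d ℕ.+ c * b) ℚ./ (b * d)) {{ℕ.m*n≢0 b d}}
/-+ a b@(suc _) c d@(suc _) = ℚ.toℚᵘ-injective (begin
  ℚ.toℚᵘ (+ a ℚ./ b ℚ.+ + c ℚ./ d)               ≈⟨ ℚ.toℚᵘ-homo-+ (+ a ℚ./ b) (+ c ℚ./ d) ⟩
  ℚ.toℚᵘ (+ a ℚ./ b) ℚᵘ.+ ℚ.toℚᵘ (+ c ℚ./ d)     ≈⟨ ℚᵘ.+-cong (toℚᵘ-/ a b) (toℚᵘ-/ c d) ⟩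
  (+ a ℤ.* + d ℤ.+ + c ℤ.* + b) ℚᵘ./ (b * d)
    ≡⟨ cong (ℚᵘ._/ (b * d)) (cong₂ ℤ._+_ (sym (ℤ.pos-* a d)) (sym (ℤ.pos-* c b))) ⟩
  + (a * d ℕ.+ c * b) ℚᵘ./ (b * d)               ≈⟨ toℚᵘ-/ (a * d ℕ.+ c * b) (b * d) ⟨
  ℚ.toℚᵘ (+ (a * d ℕ.+ c * b) ℚ./ (b * d))       ∎)
  where open ℚᵘ.≃-Reasoning

^-distribʳ-* : ∀ m n k → (m * n) ^ k ≡ m ^ k * n ^ k
^-distribʳ-* m n zero    = refl
^-distribʳ-* m n (suc k) = trans (cong (m * n *_) (^-distribʳ-* m n k)) (rearrange m n (m ^ k) (n ^ k))
  where
  rearrange : ∀ a b x y → a * b * (x * y) ≡ a * x * (b * y)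
  rearrange = solve-∀

-- The capital after σ is weight σ / d ^ |σ|.
module Betting (w : Fin 2 → ℕ) (d : ℕ) {{_ : NonZero d}} (fair : w zero ℕ.+ w (suc zero) ≡ 2 * d) where

  weight : List (Fin 2) → ℕ
  weight = product ∘ map w

  weight-∷ʳ : ∀ σ b → weight (σ ∷ʳ b) ≡ weight σ * w b
  weight-∷ʳ σ b = begin
    product (map w (σ ∷ʳ b))  ≡⟨ cong product (map-++ w σ (b ∷ [])) ⟩
    product (map w σ ∷ʳ w b)  ≡⟨ product-++ (map w σ) (w b ∷ []) ⟩
    weight σ * (w b * 1)      ≡⟨ cong (weight σ *_) (ℕ.*-identityʳ (w b)) ⟩
    weight σ * w b            ∎
    where open ≡-Reasoning

  weight-applyUpTo-suc : ∀ Y n → weight (applyUpTo Y (suc n)) ≡ weight (applyUpTo Y n) * w (Y n)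
  weight-applyUpTo-suc Y n =
    trans (cong weight (sym (applyUpTo-∷ʳ Y n))) (weight-∷ʳ (applyUpTo Y n) (Y n))

  -- The capital has reached `2 ^ m`, with denominators cleared so that the condition is a
  -- comparison of natural numbers.
  Rich : ℕ → List (Fin 2) → Set
  Rich m σ = 2 ^ m * d ^ length σ ℕ.≤ weight σ

  rich? : ∀ m → Decidable (Rich m)
  rich? m σ = 2 ^ m * d ^ length σ ℕ.≤? weight σ

  denominator : ℕ → List (Fin 2) → ℕ
  denominator m σ = 2 ^ m * (2 * d) ^ length σ

  denominator-nonZero : ∀ m σ → NonZero (denominator m σ)
  denominator-nonZero m σ =
    ℕ.m*n≢0 (2 ^ m) ((2 * d) ^ length σ) {{ℕ.m^n≢0 2 m}} {{ℕ.m^n≢0 (2 * d) (length σ) {{ℕ.m*n≢0 2 d}}}}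

  -- The measure of N σ times 2 ^ (- m) times the capital after σ.
  fraction : ℕ → List (Fin 2) → ℚ
  fraction m σ = (+ weight σ ℚ./ denominator m σ) {{denominator-nonZero m σ}}

  -- Both children have denominator `2 * d * D`, and by `fair` their numerators add up to `2 * d`
  -- times `weight σ`; the two sides are in fact equal.
  fraction-super : ∀ m σ → fraction m (σ ∷ʳ zero) ℚ.+ fraction m (σ ∷ʳ suc zero) ℚ.≤ fraction m σ
  fraction-super m σ = begin
    fraction m (σ ∷ʳ zero) ℚ.+ fraction m (σ ∷ʳ suc zero)
      ≡⟨ /-+ (weight (σ ∷ʳ zero)) D₀ (weight (σ ∷ʳ suc zero)) D₁ {{nz₀}} {{nz₁}} ⟩
    (+ (weight (σ ∷ʳ zero) * D₁ ℕ.+ weight (σ ∷ʳ suc zero) * D₀) ℚ./ (D₀ * D₁)) {{ℕ.m*n≢0 D₀ D₁ {{nz₀}} {{nz₁}}}}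
      ≤⟨ /-mono-≤ (weight (σ ∷ʳ zero) * D₁ ℕ.+ weight (σ ∷ʳ suc zero) * D₀) (D₀ * D₁) (weight σ) D
           {{ℕ.m*n≢0 D₀ D₁ {{nz₀}} {{nz₁}}}} {{nz}} (ℕ.≤-reflexive cross) ⟩
    fraction m σ ∎
    where
    open ℚ.≤-Reasoning
    D  = denominator m σ
    D₀ = denominator m (σ ∷ʳ zero)
    D₁ = denominator m (σ ∷ʳ suc zero)
    nz  = denominator-nonZero m σ
    nz₀ = denominator-nonZero m (σ ∷ʳ zero)
    nz₁ = denominator-nonZero m (σ ∷ʳ suc zero)

    D-∷ʳ : ∀ b → denominator m (σ ∷ʳ b) ≡ 2 * d * D
    D-∷ʳ b = trans (cong (λ l → 2 ^ m * (2 * d) ^ l) (length-∷ʳ σ b)) (rearrange (2 ^ m) (2 * d) ((2 * d) ^ length σ))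
      where
      rearrange : ∀ x y z → x * (y * z) ≡ y * (x * z)
      rearrange = solve-∀

    rearrange : ∀ W w₀ w₁ e D → (W * w₀ * (e * D) ℕ.+ W * w₁ * (e * D)) * D ≡ W * D * e * D * (w₀ ℕ.+ w₁)
    rearrange = solve-∀

    rearrange′ : ∀ W e D → W * D * e * D * e ≡ W * ((e * D) * (e * D))
    rearrange′ = solve-∀

    cross : (weight (σ ∷ʳ zero) * D₁ ℕ.+ weight (σ ∷ʳ suc zero) * D₀) * D ≡ weight σ * (D₀ * D₁)
    cross rewrite D-∷ʳ zero | D-∷ʳ (suc zero) | weight-∷ʳ σ zero | weight-∷ʳ σ (suc zero) =
      trans (rearrange (weight σ) (w zero) (w (suc zero)) (2 * d) D)
        (trans (cong (weight σ * D * (2 * d) * D *_) fair) (rearrange′ (weight σ) (2 * d) D))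

  -- Capital at least `2 ^ m` cancels the factor `2 ^ (- m)` in `fraction`.
  rich⇒≤fraction : ∀ m {σ} → Rich m σ → 2^- (length σ) ℚ.≤ fraction m σ
  rich⇒≤fraction m {σ} rich =
    /-mono-≤ 1 (2 ^ length σ) (weight σ) (denominator m σ) {{ℕ.m^n≢0 2 (length σ)}} {{denominator-nonZero m σ}} (begin
      1 * denominator m σ                         ≡⟨ ℕ.*-identityˡ _ ⟩
      2 ^ m * (2 * d) ^ length σ                  ≡⟨ cong (2 ^ m *_) (^-distribʳ-* 2 d (length σ)) ⟩
      2 ^ m * (2 ^ length σ * d ^ length σ)       ≡⟨ rearrange (2 ^ m) _ _ ⟩
      2 ^ m * d ^ length σ * 2 ^ length σ         ≤⟨ ℕ.*-monoˡ-≤ (2 ^ length σ) rich ⟩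
      weight σ * 2 ^ length σ                     ∎)
    where
    open ℕ.≤-Reasoning
    rearrange : ∀ x y z → x * (y * z) ≡ x * z * y
    rearrange = solve-∀

  -- The Martin-Löf test of successful bets

  module _ (μ : BorelMeasure) (coin : IsCoinTossing μ) where
    open Ville μ coin

    everRich : ℕ → BorelSet
    everRich m = everHit (rich? m)

    everRich-≤ : ∀ m {q} → below (measure μ (everRich m)) q → q ℚ.< 2^- m
    everRich-≤ m q<μ = ℚ.<-≤-trans
      (everHit-⊑ (rich? m) (fraction m)
        (λ σ → /-mono-≤ 0 1 (weight σ) (denominator m σ) {{_}} {{denominator-nonZero m σ}} ℕ.z≤n)
        (fraction-super m) (λ {σ} → rich⇒≤fraction m {σ}) q<μ)
      -- The initial capital is 1, so `fraction m []` is `1 / 2 ^ m`.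
      (/-mono-≤ 1 (denominator m []) 1 (2 ^ m) {{denominator-nonZero m []}} {{ℕ.m^n≢0 2 m}}
        (ℕ.≤-reflexive (cong (1 *_) (sym (ℕ.*-identityʳ (2 ^ m))))))

    everRich-uniformlyΣ⁰₁ : UniformlyΣ⁰₁ (set ∘ everRich)
    everRich-uniformlyΣ⁰₁ = zero-search-uniformlyΣ⁰₁ deficit-computable _ λ m →
      (λ Y∈ → let n , rich = proj₁ (everHit≐ (rich? m)) Y∈
              in n , trans (deficit-pair _ m n) (ℕ.m≤n⇒m∸n≡0 rich))
      , λ { (n , deficit≡0) → proj₂ (everHit≐ (rich? m))
              (n , ℕ.m∸n≡0⇒m≤n (trans (sym (deficit-pair _ m n)) deficit≡0)) }
      where
      -- Truncated subtraction turns the inequality `Rich` into the vanishing of a computable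
      -- function, as the zero search requires.
      deficit : Cantor → ℕ → ℕ
      deficit Y y = 2 ^ π₁ y * d ^ π₂ y ∸ weight (applyUpTo Y (π₂ y))

      deficit-pair : ∀ Y m n → deficit Y ⟨ m , n ⟩ ≡
                     2 ^ m * d ^ length (applyUpTo Y n) ∸ weight (applyUpTo Y n)
      deficit-pair Y m n rewrite unpair-pair m n | length-applyUpTo Y n = refl

      -- Case distinction on a bit is a recursion of length 0 or 1.
      natrec-w : ∀ b → natrec (w zero) (λ _ _ → w (suc zero)) (toℕ b) ≡ w b
      natrec-w zero       = refl
      natrec-w (suc zero) = refl

      natrec-weight : ∀ Y n → natrec 1 (λ n z → z * w (Y n)) n ≡ weight (applyUpTo Y n)
      natrec-weight Y zero    = refl
      natrec-weight Y (suc n) =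
        trans (cong (_* w (Y n)) (natrec-weight Y n)) (sym (weight-applyUpTo-suc Y n))

      weight-computable : Computable (λ Y n → weight (applyUpTo Y n))
      weight-computable = ≡-computable natrec-weight
        (natrec-computable (const-computable 1)
          (*-computable (π₂-computable (π₂-computable id-computable))
            (≡-computable (λ Y y → natrec-w (Y _))
              (natrec-computable (const-computable _) (const-computable _)
                (oracle-computable (π₁-computable (π₂-computable id-computable))))))
          id-computable)

      deficit-computable : Computable deficit
      deficit-computable = ∸-computable
        (*-computable (^-computable (const-computable 2) (π₁-computable id-computable))
                      (^-computable (const-computable d) (π₂-computable id-computable)))
        (∘-computable weight-computable (π₂-computable id-computable))

    -- Otherwise `X` would lie in the intersection of the sets `everRich m`, which is effectively
    -- null.
    random⇒¬rich : ∀ X → Random μ X → ¬ (∀ m → ∃[ n ] Rich m (applyUpTo X n))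
    random⇒¬rich X random rich =
      random ((λ Y → ∀ m → Y ∈ set (everRich m))
             , (everRich , everRich-uniformlyΣ⁰₁ , everRich-≤ , λ m Y∈ → Y∈ m)
             , λ m → proj₂ (everHit≐ (rich? m)) (rich m))

-- Growth of the capital

-- (1 + 1/x) ^ i ≤ ∏_{r < i} (1 + 1/(l + r)), and this product telescopes.
suc^*≤^*+ : ∀ x l i → l ℕ.+ i ℕ.≤ suc x → suc x ^ i * l ℕ.≤ x ^ i * (l ℕ.+ i)
suc^*≤^*+ x l zero    _ = ℕ.≤-reflexive (cong (1 *_) (sym (ℕ.+-identityʳ l)))
suc^*≤^*+ x l (suc i) l+1+i≤1+x = begin
  suc x * suc x ^ i * l                           ≡⟨ ℕ.*-assoc (suc x) (suc x ^ i) l ⟩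
  suc x * (suc x ^ i * l)                         ≤⟨ ℕ.*-monoʳ-≤ (suc x) (suc^*≤^*+ x l i (ℕ.m≤n⇒m≤1+n l+i≤x)) ⟩
  suc x * (x ^ i * (l ℕ.+ i))                     ≡⟨ rearrange x (x ^ i) (l ℕ.+ i) ⟩
  x ^ i * (l ℕ.+ i ℕ.+ x * (l ℕ.+ i))             ≤⟨ ℕ.*-monoʳ-≤ (x ^ i) (ℕ.+-monoˡ-≤ (x * (l ℕ.+ i)) l+i≤x) ⟩
  x ^ i * (x ℕ.+ x * (l ℕ.+ i))                   ≡⟨ rearrange′ x (x ^ i) l i ⟩
  x * x ^ i * (l ℕ.+ suc i)                       ∎
  where
  open ℕ.≤-Reasoning
  l+i≤x : l ℕ.+ i ℕ.≤ x
  l+i≤x = ℕ.s≤s⁻¹ (subst (ℕ._≤ suc x) (ℕ.+-suc l i) l+1+i≤1+x)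
  rearrange : ∀ x z s → suc x * (z * s) ≡ z * (s ℕ.+ x * s)
  rearrange = solve-∀
  rearrange′ : ∀ x z l i → z * (x ℕ.+ x * (l ℕ.+ i)) ≡ x * z * (l ℕ.+ suc i)
  rearrange′ = solve-∀

-- Since `p * q` is `k ^ 2 - 1`, put `x = p * q` and `y = x + 1 = k ^ 2`. Telescoping gives
-- `(y / x) ^ q ≤ p / k`, and `k < p` makes the final comparison strict.
growth-rate : ∀ q .{{_ : NonZero q}} → let k = suc q ; p = suc k in
              k ^ (2 * k) ℕ.< p ^ suc k * q ^ q
growth-rate q = begin-strict
  k ^ (2 * k)                 ≡⟨ ℕ.^-*-assoc k 2 k ⟨
  (k ^ 2) ^ k                 ≡⟨ cong (_^ k) (square q) ⟩
  y * y ^ q                   ≡⟨ rearrange q (y ^ q) ⟩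
  (y ^ q * k) * k             ≤⟨ ℕ.*-monoˡ-≤ k (ℕ.*-cancelʳ-≤ (y ^ q * k) (x ^ q * p) q bernoulli) ⟩
  (x ^ q * p) * k             <⟨ ℕ.*-monoʳ-< (x ^ q * p) {{x^q*p≢0}} (ℕ.n<1+n k) ⟩
  (x ^ q * p) * p             ≡⟨ cong (λ z → z * p * p) (^-distribʳ-* p q q) ⟩
  p ^ q * q ^ q * p * p       ≡⟨ rearrange′ p (p ^ q) (q ^ q) ⟩
  p ^ suc k * q ^ q           ∎
  where
  open ℕ.≤-Reasoning
  k = suc q
  p = suc k
  x = p * q
  y = suc x
  x^q*p≢0 : NonZero (x ^ q * p)
  x^q*p≢0 = ℕ.m*n≢0 (x ^ q) p {{ℕ.m^n≢0 x q {{ℕ.m*n≢0 p q}}}}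
  square : ∀ q → suc q * (suc q * 1) ≡ suc (suc (suc q) * q)
  square = solve-∀
  rearrange : ∀ q z → suc (suc (suc q) * q) * z ≡ z * suc q * suc q
  rearrange = solve-∀
  rearrange′ : ∀ p z z′ → z * z′ * p * p ≡ p * (p * z) * z′
  rearrange′ = solve-∀
  l+q≡x : ∀ q → suc q * q ℕ.+ q ≡ suc (suc q) * q
  l+q≡x = solve-∀
  bernoulli : y ^ q * k * q ℕ.≤ x ^ q * p * q
  bernoulli = begin
    y ^ q * k * q               ≡⟨ ℕ.*-assoc (y ^ q) k q ⟩
    -- Starting the product at `l = k * q` gives `l + q = x`, and the telescoped quotient
    -- `(l + q) / l` is `p / k`.
    y ^ q * (k * q)             ≤⟨ suc^*≤^*+ x (k * q) q (ℕ.m≤n⇒m≤1+n (ℕ.≤-reflexive (l+q≡x q))) ⟩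
    x ^ q * (k * q ℕ.+ q)       ≡⟨ cong (x ^ q *_) (l+q≡x q) ⟩
    x ^ q * (p * q)             ≡⟨ ℕ.*-assoc (x ^ q) p q ⟨
    x ^ q * p * q               ∎

-- Bernoulli's inequality `(1 + 1/a) ^ n ≥ 1 + n/a`, whose right side exceeds `c` once `n` is at
-- least `a * c`.
*^≤suc^ : ∀ a .{{_ : NonZero a}} c n → a * c ℕ.≤ n → c * a ^ n ℕ.≤ suc a ^ n
*^≤suc^ a c n ac≤n = ℕ.*-cancelˡ-≤ a (begin
  a * (c * a ^ n)             ≡⟨ ℕ.*-assoc a c (a ^ n) ⟨
  a * c * a ^ n               ≤⟨ ℕ.*-monoˡ-≤ (a ^ n) (ℕ.m≤n⇒m≤o+n a ac≤n) ⟩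
  (a ℕ.+ n) * a ^ n           ≤⟨ bernoulli n ⟩
  a * suc a ^ n               ∎)
  where
  open ℕ.≤-Reasoning
  rearrange : ∀ a n z → (a ℕ.+ suc n) * (a * z) ℕ.+ n * z ≡ suc a * ((a ℕ.+ n) * z)
  rearrange = solve-∀
  rearrange′ : ∀ a z → suc a * (a * z) ≡ a * (suc a * z)
  rearrange′ = solve-∀
  bernoulli : ∀ n → (a ℕ.+ n) * a ^ n ℕ.≤ a * suc a ^ n
  bernoulli zero    = ℕ.*-monoˡ-≤ 1 (ℕ.≤-reflexive (ℕ.+-identityʳ a))
  bernoulli (suc n) = begin
    (a ℕ.+ suc n) * (a * a ^ n)                   ≤⟨ ℕ.m≤m+n _ (n * a ^ n) ⟩
    (a ℕ.+ suc n) * (a * a ^ n) ℕ.+ n * a ^ n     ≡⟨ rearrange a n (a ^ n) ⟩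
    suc a * ((a ℕ.+ n) * a ^ n)                   ≤⟨ ℕ.*-monoʳ-≤ (suc a) (bernoulli n) ⟩
    suc a * (a * suc a ^ n)                       ≡⟨ rearrange′ a (suc a ^ n) ⟩
    a * (suc a * suc a ^ n)                       ∎

^*^-exchange : ∀ {p q} e a b → q ℕ.≤ p → p ^ a * q ^ (b ℕ.+ e) ℕ.≤ p ^ (a ℕ.+ e) * q ^ b
^*^-exchange {p} {q} e a b q≤p = begin
  p ^ a * q ^ (b ℕ.+ e)       ≡⟨ cong (p ^ a *_) (ℕ.^-distribˡ-+-* q b e) ⟩
  p ^ a * (q ^ b * q ^ e)     ≤⟨ ℕ.*-monoʳ-≤ (p ^ a) (ℕ.*-monoʳ-≤ (q ^ b) (ℕ.^-monoˡ-≤ e q≤p)) ⟩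
  p ^ a * (q ^ b * p ^ e)     ≡⟨ rearrange (p ^ a) (q ^ b) (p ^ e) ⟩
  p ^ a * p ^ e * q ^ b       ≡⟨ cong (_* q ^ b) (ℕ.^-distribˡ-+-* p a e) ⟨
  p ^ (a ℕ.+ e) * q ^ b       ∎
  where
  open ℕ.≤-Reasoning
  rearrange : ∀ x y z → x * (y * z) ≡ x * z * y
  rearrange = solve-∀

-- The 2k-th power of the capital makes the exponents integral.
capital-growth : ∀ q .{{_ : NonZero q}} m {n s t} → let k = suc q ; p = suc k in
  s ℕ.+ t ≡ n → suc k * n ℕ.≤ 2 * k * s → k ^ (2 * k) * (2 ^ m) ^ (2 * k) ℕ.≤ n →
  2 ^ m * k ^ n ℕ.≤ p ^ s * q ^ t
capital-growth q m {n} {s} {t} s+t≡n excess n-large = ℕ.≮⇒≥ λ poor →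
  ℕ.<-irrefl refl (begin-strict
    (p ^ s * q ^ t) ^ r                 <⟨ ℕ.^-monoˡ-< r poor ⟩
    (2 ^ m * k ^ n) ^ r                 ≡⟨ ^-distribʳ-* (2 ^ m) (k ^ n) r ⟩
    (2 ^ m) ^ r * (k ^ n) ^ r           ≡⟨ cong ((2 ^ m) ^ r *_) (^-^-comm k n r) ⟩
    -- For natural numbers, strictness in `growth-rate` means a base of at least `k ^ r + 1`;
    -- Bernoulli's inequality for that base absorbs the target `(2 ^ m) ^ r`.
    (2 ^ m) ^ r * (k ^ r) ^ n           ≤⟨ *^≤suc^ (k ^ r) {{ℕ.m^n≢0 k r}} ((2 ^ m) ^ r) n n-large ⟩
    suc (k ^ r) ^ n                     ≤⟨ ℕ.^-monoˡ-≤ n (growth-rate q) ⟩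
    (p ^ suc k * q ^ q) ^ n             ≡⟨ ^-distribʳ-* (p ^ suc k) (q ^ q) n ⟩
    (p ^ suc k) ^ n * (q ^ q) ^ n       ≡⟨ cong₂ _*_ (ℕ.^-*-assoc p (suc k) n) (ℕ.^-*-assoc q q n) ⟩
    p ^ (suc k * n) * q ^ (q * n)       ≡⟨ cong (λ i → p ^ (suc k * n) * q ^ i) qn≡rt+e ⟩
    p ^ (suc k * n) * q ^ (r * t ℕ.+ e) ≤⟨ ^*^-exchange {p} {q} e (suc k * n) (r * t) (ℕ.m≤n⇒m≤1+n (ℕ.n≤1+n q)) ⟩
    p ^ (suc k * n ℕ.+ e) * q ^ (r * t) ≡⟨ cong (λ i → p ^ i * q ^ (r * t)) kn+e≡rs ⟩
    p ^ (r * s) * q ^ (r * t)           ≡⟨ cong₂ _*_ (power p s) (power q t) ⟩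
    (p ^ s) ^ r * (q ^ t) ^ r           ≡⟨ ^-distribʳ-* (p ^ s) (q ^ t) r ⟨
    (p ^ s * q ^ t) ^ r                 ∎)
  where
  open ℕ.≤-Reasoning
  k = suc q
  p = suc k
  r = 2 * k

  -- The surplus of `r * s` over `suc k * n`. As `suc k + q` is `r`, it is also the surplus of
  -- `q * n` over `r * t`, so `e` factors `q` can be traded for factors `p`.
  e : ℕ
  e = proj₁ (ℕ.m≤n⇒∃[o]m+o≡n excess)

  kn+e≡rs : suc k * n ℕ.+ e ≡ r * s
  kn+e≡rs = proj₂ (ℕ.m≤n⇒∃[o]m+o≡n excess)

  power : ∀ b i → b ^ (r * i) ≡ (b ^ i) ^ r
  power b i = trans (cong (b ^_) (ℕ.*-comm r i)) (sym (ℕ.^-*-assoc b i r))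

  ^-^-comm : ∀ b i j → (b ^ i) ^ j ≡ (b ^ j) ^ i
  ^-^-comm b i j = trans (ℕ.^-*-assoc b i j) (trans (cong (b ^_) (ℕ.*-comm i j)) (sym (ℕ.^-*-assoc b j i)))

  rearrange : ∀ q n → suc (suc q) * n ℕ.+ q * n ≡ 2 * suc q * n
  rearrange = solve-∀
  rearrange′ : ∀ a e b → a ℕ.+ e ℕ.+ b ≡ a ℕ.+ (b ℕ.+ e)
  rearrange′ = solve-∀

  qn≡rt+e : q * n ≡ r * t ℕ.+ e
  qn≡rt+e = ℕ.+-cancelˡ-≡ (suc k * n) _ _ (begin-equality
    suc k * n ℕ.+ q * n                 ≡⟨ rearrange q n ⟩
    r * n                               ≡⟨ cong (r *_) s+t≡n ⟨
    r * (s ℕ.+ t)                       ≡⟨ ℕ.*-distribˡ-+ r s t ⟩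
    r * s ℕ.+ r * t                     ≡⟨ cong (ℕ._+ r * t) kn+e≡rs ⟨
    suc k * n ℕ.+ e ℕ.+ r * t           ≡⟨ rearrange′ (suc k * n) e (r * t) ⟩
    suc k * n ℕ.+ (r * t ℕ.+ e)         ∎)

-- Frequencies of the two symbols

digitSum-opposite : ∀ Y n → digitSum Y n ℕ.+ digitSum (opposite ∘ Y) n ≡ n
digitSum-opposite Y zero    = refl
digitSum-opposite Y (suc n) = begin
  (digitSum Y n ℕ.+ toℕ (Y n)) ℕ.+ (digitSum (opposite ∘ Y) n ℕ.+ toℕ (opposite (Y n)))
    ≡⟨ rearrange (digitSum Y n) (toℕ (Y n)) _ _ ⟩
  (toℕ (Y n) ℕ.+ toℕ (opposite (Y n))) ℕ.+ (digitSum Y n ℕ.+ digitSum (opposite ∘ Y) n)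
    ≡⟨ cong₂ ℕ._+_ (bit (Y n)) (digitSum-opposite Y n) ⟩
  suc n ∎
  where
  open ≡-Reasoning
  rearrange : ∀ a b c d → (a ℕ.+ b) ℕ.+ (c ℕ.+ d) ≡ (b ℕ.+ d) ℕ.+ (a ℕ.+ c)
  rearrange = solve-∀
  bit : ∀ b → toℕ b ℕ.+ toℕ (opposite b) ≡ 1
  bit zero       = refl
  bit (suc zero) = refl

-- The bit b is read as g b, for g the identity or the complement: this
-- covers an excess of ones and an excess of zeros at once.
module Excess (g : Fin 2 → Fin 2) (q : ℕ) {{_ : NonZero q}} where

  private
    k p : ℕ
    k = suc q
    p = suc k

  stake : Fin 2 → ℕ
  stake zero       = q
  stake (suc zero) = p

  module _ (fair : stake (g zero) ℕ.+ stake (g (suc zero)) ≡ 2 * k) where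
    open Betting (stake ∘ g) k fair

    weight-digitSum : ∀ X n → weight (applyUpTo X n) ≡
                      p ^ digitSum (g ∘ X) n * q ^ digitSum (opposite ∘ g ∘ X) n
    weight-digitSum X zero    = refl
    weight-digitSum X (suc n) = begin
      weight (applyUpTo X (suc n))                           ≡⟨ weight-applyUpTo-suc X n ⟩
      weight (applyUpTo X n) * stake (g (X n))               ≡⟨ cong₂ _*_ (weight-digitSum X n) (stake-^ (g (X n))) ⟩
      p ^ S₁ * q ^ S₀ * (p ^ toℕ b * q ^ toℕ (opposite b))   ≡⟨ rearrange (p ^ S₁) _ _ _ ⟩
      p ^ S₁ * p ^ toℕ b * (q ^ S₀ * q ^ toℕ (opposite b))
        ≡⟨ cong₂ _*_ (ℕ.^-distribˡ-+-* p S₁ _) (ℕ.^-distribˡ-+-* q S₀ _) ⟨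
      p ^ (S₁ ℕ.+ toℕ b) * q ^ (S₀ ℕ.+ toℕ (opposite b))     ∎
      where
      open ≡-Reasoning
      b  = g (X n)
      S₁ = digitSum (g ∘ X) n
      S₀ = digitSum (opposite ∘ g ∘ X) n
      rearrange : ∀ x y z z′ → x * y * (z * z′) ≡ x * z * (y * z′)
      rearrange = solve-∀
      stake-^ : ∀ b → stake b ≡ p ^ toℕ b * q ^ toℕ (opposite b)
      stake-^ zero       = sym (trans (ℕ.*-identityˡ (q * 1)) (ℕ.*-identityʳ q))
      stake-^ (suc zero) = sym (trans (ℕ.*-identityʳ (p * 1)) (ℕ.*-identityʳ p))

    -- If the excess recurred at arbitrarily late stages, the capital would reach every `2 ^ m`.
    -- Excluded middle extracts such a stage from the failure of the conclusion.
    eventually-no-excess : ExcludedMiddle 0ℓ → (μ : BorelMeasure) → IsCoinTossing μ →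
      ∀ X → Random μ X → ∃[ n₀ ] ∀ n → n₀ ℕ.≤ n → 2 * k * digitSum (g ∘ X) n ℕ.< suc k * n
    eventually-no-excess em μ coin X random = case em of λ where
        (yes eventually) → eventually
        (no ¬eventually) → contradiction (rich ¬eventually) (random⇒¬rich μ coin X random)
      where
      Eventually : Set
      Eventually = ∃[ n₀ ] ∀ n → n₀ ℕ.≤ n → 2 * k * digitSum (g ∘ X) n ℕ.< suc k * n

      rich : ¬ Eventually → ∀ m → ∃[ n ] Rich m (applyUpTo X n)
      rich ¬eventually m = case em {∃[ n ] (n₀ ℕ.≤ n × suc k * n ℕ.≤ 2 * k * digitSum (g ∘ X) n)} of λ where
          (yes (n , n₀≤n , excess)) → n ,
            subst₂ ℕ._≤_ (cong (λ l → 2 ^ m * k ^ l) (sym (length-applyUpTo X n))) (sym (weight-digitSum X n))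
              (capital-growth q m (digitSum-opposite (g ∘ X) n) excess n₀≤n)
          (no ¬excess) → contradiction
            (n₀ , λ n n₀≤n → ℕ.≰⇒> λ excess → ¬excess (n , n₀≤n , excess)) ¬eventually
        where
        -- The stage from which `capital-growth` guarantees capital `2 ^ m`.
        n₀ = k ^ (2 * k) * (2 ^ m) ^ (2 * k)

-- From symbol counts to averages

-- The bound `(k + 1) / (2k)` on the frequency is `1/2 + 1/(2k)`, and `1/(2k)` is below `1/j`.
no-excess⇒<½+ : ∀ a j n s .{{_ : NonZero n}} .{{_ : NonZero j}} → let k = 2 ℕ.+ j in
  2 * k * s ℕ.< suc k * n → + s ℚ./ n ℚ.- ½ ℚ.< + suc a ℚ./ j
no-excess⇒<½+ a j n s no-excess =
  subst (+ s ℚ./ n ℚ.- ½ ℚ.<_) (xyx⁻¹≈y ½ (+ suc a ℚ./ j)) (ℚ.+-monoˡ-< (ℚ.- ½) (begin-strict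
    + s ℚ./ n
      <⟨ /-mono-< s n (suc k) (2 * k) (subst (ℕ._< suc k * n) (ℕ.*-comm (2 * k) s) no-excess) ⟩
    + suc k ℚ./ (2 * k)
      ≤⟨ /-mono-≤ (suc k) (2 * k) (1 * j ℕ.+ suc a * 2) (2 * j) {{_}} {{ℕ.m*n≢0 2 j}} cross ⟩
    (+ (1 * j ℕ.+ suc a * 2) ℚ./ (2 * j)) {{ℕ.m*n≢0 2 j}}  ≡⟨ /-+ 1 2 (suc a) j ⟨
    ½ ℚ.+ + suc a ℚ./ j                           ∎))
  where
  open ℚ.≤-Reasoning
  k = 2 ℕ.+ j
  expand : ∀ a j → (1 * j ℕ.+ suc a * 2) * (2 * (2 ℕ.+ j)) ≡
                   (3 ℕ.+ j) * (2 * j) ℕ.+ (2 * j ℕ.+ 4 * (a * j) ℕ.+ 8 * a ℕ.+ 8)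
  expand = solve-∀
  cross : suc k * (2 * j) ℕ.≤ (1 * j ℕ.+ suc a * 2) * (2 * k)
  cross = subst (suc k * (2 * j) ℕ.≤_) (sym (expand a j)) (ℕ.m≤m+n _ _)

-- The two averages add up to 1, so their deviations from `½` cancel.
complementary-averages : ∀ n s t .{{_ : NonZero n}} → s ℕ.+ t ≡ n →
                         + t ℚ./ n ℚ.- ½ ≡ ℚ.- (+ s ℚ./ n ℚ.- ½)
complementary-averages n s t s+t≡n = inverseˡ-unique _ _ (begin
  (+ t ℚ./ n ℚ.- ½) ℚ.+ (+ s ℚ./ n ℚ.- ½)              ≡⟨ interchange (+ t ℚ./ n) (ℚ.- ½) (+ s ℚ./ n) (ℚ.- ½) ⟩
  (+ t ℚ./ n ℚ.+ + s ℚ./ n) ℚ.+ (ℚ.- ½ ℚ.- ½)          ≡⟨ cong (ℚ._+ (ℚ.- ½ ℚ.- ½)) total ⟩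
  1ℚ ℚ.+ (ℚ.- ½ ℚ.- ½)                                 ≡⟨⟩
  0ℚ                                                   ∎)
  where
  open ≡-Reasoning
  cross : (t * n ℕ.+ s * n) * 1 ≡ 1 * (n * n)
  cross = trans (rearrange n s t) (cong (λ z → 1 * (z * n)) s+t≡n)
    where
    rearrange : ∀ n s t → (t * n ℕ.+ s * n) * 1 ≡ 1 * ((s ℕ.+ t) * n)
    rearrange = solve-∀
  total : + t ℚ./ n ℚ.+ + s ℚ./ n ≡ 1ℚ
  total = trans (/-+ t n s n) (ℚ.≤-antisym
    (/-mono-≤ (t * n ℕ.+ s * n) (n * n) 1 1 {{ℕ.m*n≢0 n n}} (ℕ.≤-reflexive cross))
    (/-mono-≤ 1 1 (t * n ℕ.+ s * n) (n * n) {{_}} {{ℕ.m*n≢0 n n}} (ℕ.≤-reflexive (sym cross))))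

theorem3p2 : ExcludedMiddle 0ℓ →
    (μ : BorelMeasure) → IsCoinTossing μ →
    (X : Cantor) → Random μ X →
    average X ⟶ ½
theorem3p2 em μ coin X random (mkℚ (+ 0)      _ _) (ℚ.*<* (+<+ ()))
theorem3p2 em μ coin X random (mkℚ -[1+ _ ]   _ _) (ℚ.*<* ())
theorem3p2 em μ coin X random ε@(mkℚ (+ suc a) d _) 0<ε =
  n₁ ℕ.⊔ n₀ , λ n n₁⊔n₀≤n → close n
    (ones n (ℕ.m⊔n≤o⇒m≤o n₁ n₀ n₁⊔n₀≤n)) (zeros n (ℕ.m⊔n≤o⇒n≤o n₁ n₀ n₁⊔n₀≤n))
  where
  -- `mkℚ` stores the denominator minus one, so `j` is the denominator of `ε`. Then `k` is `j + 2`,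
  -- as `no-excess⇒<½+` expects.
  j = suc d
  q = suc j
  k = suc q

  fair-id : ∀ q → q ℕ.+ suc (suc q) ≡ 2 * suc q
  fair-id = solve-∀
  fair-opposite : ∀ q → suc (suc q) ℕ.+ q ≡ 2 * suc q
  fair-opposite = solve-∀

  eventually-ones  = Excess.eventually-no-excess id q (fair-id q) em μ coin X random
  eventually-zeros = Excess.eventually-no-excess opposite q (fair-opposite q) em μ coin X random
  n₁    = proj₁ eventually-ones
  ones  = proj₂ eventually-ones
  n₀    = proj₁ eventually-zeros
  zeros = proj₂ eventually-zeros

  close : ∀ n .{{_ : NonZero n}} → 2 * k * digitSum X n ℕ.< suc k * n →
          2 * k * digitSum (opposite ∘ X) n ℕ.< suc k * n → ℚ.∣ average X n ℚ.- ½ ∣ ℚ.< ε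
  -- A deviation equal to its absolute value is bounded by the count of ones; in the other case its
  -- negative is the deviation of the complemented sequence, bounded by the count of zeros.
  close n few-ones few-zeros with ℚ.∣p∣≡p∨∣p∣≡-p (average X n ℚ.- ½)
  ... | inj₁ eq = subst₂ ℚ._<_ (sym eq) (ℚ.↥p/↧p≡p ε) (no-excess⇒<½+ a j n (digitSum X n) few-ones)
  ... | inj₂ eq = subst₂ ℚ._<_
    (trans (complementary-averages n (digitSum X n) (digitSum (opposite ∘ X) n) (digitSum-opposite X n)) (sym eq))
    (ℚ.↥p/↧p≡p ε) (no-excess⇒<½+ a j n (digitSum (opposite ∘ X) n) few-zeros)
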